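{- Let $G=(V,E)$ be an undirected graph with $V=\{v_1,\dots,v_n\}$ and let $w_v\ge 0$ $(v\in V)$ be weights. Define the graph $H(G)=(V^1\cup V^2,\;E^1\cup E^2\cup E^3)$, where $V^1=\{v^1_1,\dots,v^1_n\}$ and $V^2=\{v^2_1,\dots,v^2_n\}$ are disjoint sets of $n$ distinct nodes each, and $$E^1=\{\{v^1_i,v^1_j\} : i<j,\ \{v_i,v_j\}\in E\},\quad E^2=\{\{v^2_i,v^2_j\} : i<j,\ \{v_i,v_j\}\in E\},\quad E^3=\{\{v^1_i,v^2_i\} : i\in\{1,\dots,n\}\},$$ with node weights $w_{v^1_i}=w_{v^2_i}=w_{v_i}$ for all $i\in\{1,\dots,n\}$. Then any independent set $W^I$ of $H(G)$ can be transformed into a set $W^B\subseteq V$ such that $G(W^B)$ is bipartite, without changing the total weight, and vice versa. That is: (1) for every independent set $W^I$ of $H(G)$ there is a set $W^B\subseteq V$ such that $G(W^B)$ is bipartite and $\sum_{v\in W^B}w_v=\sum_{u\in W^I}w_u$; and (2) for every set $W^B\subseteq V$ such that $G(W^B)$ is bipartite there is an independent set $W^I$ of $H(G)$ with $\sum_{u\in W^I}w_u=\sum_{v\in W^B}w_v$.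
   Context: Graphs are finite and undirected, and edges are unordered pairs of distinct nodes. For a graph $G=(V,E)$ and $W\subseteq V$, let $E(W)=\{\{u,v\}\in E : u,v\in W\}$; the graph $G(W)=(W,E(W))$ is the subgraph of $G$ induced by $W$. A set $W\subseteq V$ is an independent set of $G$ if $E(W)=\emptyset$. A graph is bipartite if its nodes can be partitioned into two disjoint sets (possibly empty) such that no two nodes within the same set are adjacent. The total weight of a set of nodes is the sum of the weights of its elements. -}

module Defs where

open import Algebra.Bundles using (AbelianGroup)
import Algebra.Definitions.RawMonoid as RawMonoidDefinitions
open import Data.Bool.Base using (if_then_else_)
open import Data.Fin.Base using (Fin; _<_; splitAt)
open import Data.Fin.Properties using (_<?_; _≟_)
open import Data.Fin.Subset using (Subset)
open import Data.Nat.Base using (ℕ; _+_)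
open import Data.Product.Base using (∃; ∃₂; _×_; _,_; proj₁)
open import Data.Sum.Base using (_⊎_; inj₁; inj₂; [_,_])
open import Data.Vec.Base using (lookup)
open import Function.Base using (_on_)
open import Level using (Level; _⊔_; 0ℓ) renaming (suc to ℓsuc)
open import Relation.Binary.Construct.Closure.Symmetric using (SymClosure; fwd; bwd; symmetric)
open import Relation.Binary.Core using (Rel)
open import Relation.Binary.Definitions using (Decidable; Symmetric)
open import Relation.Binary.Structures using (IsPartialOrder)
open import Relation.Nullary.Decidable using (no; map′; _×-dec_; _⊎-dec_)
open import Relation.Nullary.Negation using (¬_)
open import Relation.Unary using (Pred; Universal; Empty; _∪_; _∩_)
open import Relation.Binary.PropositionalEquality.Core using (refl)

-- Adj u v means {u,v} ∈ E: a set of unordered pairs of distinct nodes is a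
-- symmetric irreflexive relation.
record Graph (V : Set) : Set₁ where
  field
    Adj        : Rel V 0ℓ
    adj?       : Decidable Adj
    adj-sym    : Symmetric Adj
    adj-irrefl : ∀ {v} → ¬ Adj v v

open Graph public

-- G(W). Its edges are E(W), since both endpoints are nodes in W.
induced : {V : Set} → Graph V → (W : Pred V 0ℓ) → Graph (∃ W)
induced G W = record
  { Adj        = Adj G on proj₁
  ; adj?       = λ u v → adj? G (proj₁ u) (proj₁ v)
  ; adj-sym    = adj-sym G
  ; adj-irrefl = adj-irrefl G
  }

Independent : {V : Set} → Graph V → Pred V 0ℓ → Set
Independent G W = ∀ u v → ¬ Adj (induced G W) u v

Bipartite : {V : Set} → Graph V → Set₁
Bipartite {V} G = ∃₂ λ (A B : Pred V 0ℓ) →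
  Universal (A ∪ B) × Empty (A ∩ B) ×
  (∀ {u v} → A u → A v → ¬ Adj G u v) ×
  (∀ {u v} → B u → B v → ¬ Adj G u v)

-- inj₁ i is v¹ᵢ and inj₂ i is v²ᵢ; each edge is listed in one orientation.
data HEdge {n : ℕ} (G : Graph (Fin n)) : Rel (Fin n ⊎ Fin n) 0ℓ where
  e¹ : ∀ {i j} → i < j → Adj G i j → HEdge G (inj₁ i) (inj₁ j)
  e² : ∀ {i j} → i < j → Adj G i j → HEdge G (inj₂ i) (inj₂ j)
  e³ : ∀ {i} → HEdge G (inj₁ i) (inj₂ i)

module _ {n : ℕ} (G : Graph (Fin n)) where

  hEdge? : Decidable (HEdge G)
  hEdge? (inj₁ i) (inj₁ j) = map′ (λ (p , q) → e¹ p q) (λ { (e¹ p q) → p , q }) (i <? j ×-dec adj? G i j)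
  hEdge? (inj₂ i) (inj₂ j) = map′ (λ (p , q) → e² p q) (λ { (e² p q) → p , q }) (i <? j ×-dec adj? G i j)
  hEdge? (inj₁ i) (inj₂ j) = map′ (λ { refl → e³ }) (λ { e³ → refl }) (i ≟ j)
  hEdge? (inj₂ i) (inj₁ j) = no λ ()

  hEdge-irrefl : ∀ {x} → ¬ HEdge G x x
  hEdge-irrefl (e¹ _ a) = adj-irrefl G a
  hEdge-irrefl (e² _ a) = adj-irrefl G a

  -- The node set Fin (n + n) is identified with V¹ ⊎ V² by splitAt: the first
  -- n elements form V¹, the last n form V².
  H : Graph (Fin (n + n))
  H = record
    { Adj        = SymClosure (HEdge G) on splitAt n
    ; adj?       = λ u v → map′ [ fwd , bwd ] (λ { (fwd e) → inj₁ e ; (bwd e) → inj₂ e })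
                     (hEdge? (splitAt n u) (splitAt n v) ⊎-dec hEdge? (splitAt n v) (splitAt n u))
    ; adj-sym    = symmetric (HEdge G)
    ; adj-irrefl = λ { (fwd e) → hEdge-irrefl e ; (bwd e) → hEdge-irrefl e }
    }

-- The domain of the weights. The usual choices (ℤ, ℚ, ℝ under addition) are all
-- instances; the order is not required to be total, so that constructive reals
-- are included as well.
record OrderedAbelianGroup (c ℓ₁ ℓ₂ : Level) : Set (ℓsuc (c ⊔ ℓ₁ ⊔ ℓ₂)) where
  infix 4 _≤_
  field
    abelianGroup : AbelianGroup c ℓ₁

  open AbelianGroup abelianGroup public
    renaming (_∙_ to _⊕_; ε to 0#; _⁻¹ to ⊖_)

  field
    _≤_            : Rel Carrier ℓ₂
    isPartialOrder : IsPartialOrder _≈_ _≤_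
    ⊕-monoʳ-≤      : ∀ x {y z} → y ≤ z → x ⊕ y ≤ x ⊕ z

module Weights {c ℓ₁ ℓ₂} (R : OrderedAbelianGroup c ℓ₁ ℓ₂) where
  open OrderedAbelianGroup R
  open RawMonoidDefinitions rawMonoid using (sum)

  weight : ∀ {n} → (Fin n → Carrier) → Subset n → Carrier
  weight w W = sum λ v → if lookup W v then w v else 0#

  H-weights : ∀ {n} → (Fin n → Carrier) → Fin (n + n) → Carrier
  H-weights {n} w u = [ w , w ] (splitAt n u)

{-# OPTIONS --safe #-}

-- An independent set of H(G) is a pair of sets W₁, W₂ ⊆ V (its traces on V¹ and
-- V²), each independent in G because of E¹ and E², and disjoint because of E³.
-- Such pairs are exactly the bipartitions of the subgraphs G(W₁ ∪ W₂), and
-- disjointness makes the weight of the union the sum of the two weights.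
module Submission where

open import Defs
open import Algebra.Bundles using (CommutativeMonoid)
import Algebra.Properties.CommutativeMonoid.Sum as Summation
open import Data.Bool.Base using (true; false; if_then_else_; _∨_)
open import Data.Fin.Base using (Fin; suc; _↑ˡ_; _↑ʳ_; splitAt; join)
open import Data.Fin.Properties using (<-cmp; splitAt-join; splitAt-↑ˡ; splitAt-↑ʳ)
open import Data.Fin.Subset using (Subset; _∈_; _∪_; _∩_; Empty; inside; outside)
open import Data.Fin.Subset.Properties using (x∈p∩q⁺; x∈p∩q⁻; x∈p∪q⁻)
open import Data.Nat.Base using (ℕ; zero; suc; _+_)
open import Data.Product.Base using (∃; ∃₂; _×_; _,_; proj₁; proj₂)
open import Data.Sum.Base using (_⊎_; inj₁; inj₂; [_,_])
import Data.Sum.Base as Sum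
open import Data.Vec.Base using (lookup; _∷_; []; _++_; here; there)
import Data.Vec.Base as Vec
open import Data.Vec.Properties
  using (lookup-++ˡ; lookup-++ʳ; lookup-splitAt; lookup-zipWith; lookup⇒[]=; []=⇒lookup)
open import Function.Base using (_∘_)
open import Level using (0ℓ)
open import Relation.Binary.Construct.Closure.Symmetric using (SymClosure; fwd; bwd)
open import Relation.Binary.Definitions using (tri<; tri≈; tri>)
open import Relation.Binary.PropositionalEquality.Core
  using (_≡_; refl; sym; trans; cong; subst₂)
open import Relation.Nullary.Negation using (¬_; contradiction)
open import Relation.Unary using (Pred)

-- `A` and `B` need not be decidable, so the two subsets cannot be obtained by filtering `W`.
-- Instead each element of `W` goes to the one side that `cover` reports for it, which makes the
-- parts disjoint even where `A` and `B` overlap.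
cover-split : ∀ {n} {A B : Pred (Fin n) 0ℓ} (W : Subset n) →
  (∀ {v} → v ∈ W → A v ⊎ B v) →
  ∃₂ λ W₁ W₂ → W ≡ W₁ ∪ W₂ × Empty (W₁ ∩ W₂) ×
    (∀ {v} → v ∈ W₁ → A v) × (∀ {v} → v ∈ W₂ → B v)
cover-split [] cover = [] , [] , refl , (λ ()) , (λ ()) , λ ()
cover-split (outside ∷ W) cover with cover-split W (cover ∘ there)
... | W₁ , W₂ , eq , disj , W₁⊆A , W₂⊆B =
  outside ∷ W₁ , outside ∷ W₂ , cong (outside ∷_) eq ,
  (λ { (suc v , there p) → disj (v , p) }) ,
  (λ { (there p) → W₁⊆A p }) , (λ { (there p) → W₂⊆B p })
cover-split (inside ∷ W) cover with cover-split W (cover ∘ there) | cover here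
... | W₁ , W₂ , eq , disj , W₁⊆A , W₂⊆B | inj₁ a =
  inside ∷ W₁ , outside ∷ W₂ , cong (inside ∷_) eq ,
  (λ { (suc v , there p) → disj (v , p) }) ,
  (λ { here → a ; (there p) → W₁⊆A p }) , (λ { (there p) → W₂⊆B p })
... | W₁ , W₂ , eq , disj , W₁⊆A , W₂⊆B | inj₂ b =
  outside ∷ W₁ , inside ∷ W₂ , cong (inside ∷_) eq ,
  (λ { (suc v , there p) → disj (v , p) }) ,
  (λ { (there p) → W₁⊆A p }) , (λ { here → b ; (there p) → W₂⊆B p })

-- The form that membership in `p ++ q` takes after `splitAt`: once an `HEdge` is matched, it
-- computes to membership in one of the two traces.
_∈⊎_ : ∀ {m n} → Fin m ⊎ Fin n → Subset m × Subset n → Set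
x ∈⊎ (p , q) = [ _∈ p , _∈ q ] x

join-∈-++ : ∀ {m n} {p : Subset m} {q : Subset n} x → x ∈⊎ (p , q) → join m n x ∈ p ++ q
join-∈-++ {p = p} {q} (inj₁ i) i∈p =
  lookup⇒[]= _ (p ++ q) (trans (lookup-++ˡ p q i) ([]=⇒lookup i∈p))
join-∈-++ {p = p} {q} (inj₂ j) j∈q =
  lookup⇒[]= _ (p ++ q) (trans (lookup-++ʳ p q j) ([]=⇒lookup j∈q))

splitAt-∈-++ : ∀ {m n} (p : Subset m) (q : Subset n) {u} → u ∈ p ++ q → splitAt m u ∈⊎ (p , q)
-- Abstracting `splitAt m u` together with the equation lets the type of the equation compute in
-- each case.
splitAt-∈-++ {m} p q {u} u∈ with splitAt m u | trans (sym (lookup-splitAt m p q u)) ([]=⇒lookup u∈)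
... | inj₁ i | eq = lookup⇒[]= i p eq
... | inj₂ j | eq = lookup⇒[]= j q eq

-- The link between the two sides of the theorem. Subsets replace the predicates of `Bipartite`, so
-- that `W₁ ∪ W₂` and `W₁ ++ W₂` both have weights.
IsBipartition : ∀ {n} → Graph (Fin n) → Subset n → Subset n → Set
IsBipartition G W₁ W₂ = Independent G (_∈ W₁) × Independent G (_∈ W₂) × Empty (W₁ ∩ W₂)

module _ {n : ℕ} (G : Graph (Fin n)) {W₁ W₂ : Subset n} where

  IsBipartition⇒Bipartite : IsBipartition G W₁ W₂ → Bipartite (induced G (_∈ W₁ ∪ W₂))
  IsBipartition⇒Bipartite (ind₁ , ind₂ , disj) =
    (λ v → proj₁ v ∈ W₁) , (λ v → proj₁ v ∈ W₂) ,
    (λ v → x∈p∪q⁻ W₁ W₂ (proj₂ v)) ,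
    (λ v (v∈W₁ , v∈W₂) → disj (proj₁ v , x∈p∩q⁺ (v∈W₁ , v∈W₂))) ,
    (λ u∈ v∈ → ind₁ (_ , u∈) (_ , v∈)) ,
    (λ u∈ v∈ → ind₂ (_ , u∈) (_ , v∈))

  IsBipartition⇒Independent-H : IsBipartition G W₁ W₂ → Independent (H G) (_∈ W₁ ++ W₂)
  IsBipartition⇒Independent-H (ind₁ , ind₂ , disj) (_ , u∈) (_ , v∈) = λ where
      (fwd e) → no-edge (splitAt-∈-++ W₁ W₂ u∈) (splitAt-∈-++ W₁ W₂ v∈) e
      (bwd e) → no-edge (splitAt-∈-++ W₁ W₂ v∈) (splitAt-∈-++ W₁ W₂ u∈) e
    where
    no-edge : ∀ {x y} → x ∈⊎ (W₁ , W₂) → y ∈⊎ (W₁ , W₂) → ¬ HEdge G x y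
    no-edge x∈ y∈ (e¹ _ a) = ind₁ (_ , x∈) (_ , y∈) a
    no-edge x∈ y∈ (e² _ a) = ind₂ (_ , x∈) (_ , y∈) a
    no-edge x∈ y∈ e³       = disj (_ , x∈p∩q⁺ (x∈ , y∈))

  Independent-H⇒IsBipartition : Independent (H G) (_∈ W₁ ++ W₂) → IsBipartition G W₁ W₂
  Independent-H⇒IsBipartition ind = ind₁ , ind₂ , disj
    where
    no-edge : ∀ x y → x ∈⊎ (W₁ , W₂) → y ∈⊎ (W₁ , W₂) → ¬ HEdge G x y
    no-edge x y x∈ y∈ e = ind (_ , join-∈-++ x x∈) (_ , join-∈-++ y y∈)
      -- Adjacency in `H G` is read through `splitAt`, so the edge between `x` and `y` is carried
      -- back along `splitAt-join`.
      (subst₂ (SymClosure (HEdge G)) (sym (splitAt-join n n x)) (sym (splitAt-join n n y)) (fwd e))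

    ind₁ : Independent G (_∈ W₁)
    -- `e¹` exists only for increasing indices, so an edge of `G` is first oriented; equal indices
    -- would give a loop.
    ind₁ (i , i∈) (j , j∈) a with <-cmp i j
    ... | tri< i<j _ _  = no-edge (inj₁ i) (inj₁ j) i∈ j∈ (e¹ i<j a)
    ... | tri≈ _ refl _ = adj-irrefl G a
    ... | tri> _ _ j<i  = no-edge (inj₁ j) (inj₁ i) j∈ i∈ (e¹ j<i (adj-sym G a))

    ind₂ : Independent G (_∈ W₂)
    ind₂ (i , i∈) (j , j∈) a with <-cmp i j
    ... | tri< i<j _ _  = no-edge (inj₂ i) (inj₂ j) i∈ j∈ (e² i<j a)
    ... | tri≈ _ refl _ = adj-irrefl G a
    ... | tri> _ _ j<i  = no-edge (inj₂ j) (inj₂ i) j∈ i∈ (e² j<i (adj-sym G a))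

    disj : Empty (W₁ ∩ W₂)
    disj (v , v∈) = let v∈W₁ , v∈W₂ = x∈p∩q⁻ W₁ W₂ v∈ in
      no-edge (inj₁ v) (inj₂ v) v∈W₁ v∈W₂ e³

Bipartite⇒IsBipartition : ∀ {n} (G : Graph (Fin n)) (W : Subset n) →
  Bipartite (induced G (_∈ W)) → ∃₂ λ W₁ W₂ → W ≡ W₁ ∪ W₂ × IsBipartition G W₁ W₂
Bipartite⇒IsBipartition G W (A , B , cover , _ , indA , indB)
  -- The two classes live on the nodes of the induced subgraph; bundling a membership proof extends
  -- them to predicates on all of `Fin n`.
  with cover-split {A = λ v → ∃ λ v∈W → A (v , v∈W)} {B = λ v → ∃ λ v∈W → B (v , v∈W)} W
         (λ v∈W → Sum.map (v∈W ,_) (v∈W ,_) (cover (_ , v∈W)))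
... | W₁ , W₂ , eq , disj , W₁⊆A , W₂⊆B =
  W₁ , W₂ , eq ,
  (λ (_ , u∈) (_ , v∈) → indA (proj₂ (W₁⊆A u∈)) (proj₂ (W₁⊆A v∈))) ,
  (λ (_ , u∈) (_ , v∈) → indB (proj₂ (W₂⊆B u∈)) (proj₂ (W₂⊆B v∈))) ,
  disj

module _ {a ℓ} (M : CommutativeMonoid a ℓ) where
  open CommutativeMonoid M using (Carrier; _≈_; _∙_; ε; ∙-congˡ; identityˡ; identityʳ; assoc)
    renaming (sym to ≈-sym; trans to ≈-trans)
  open Summation M using (sum)

  sum-↑ : ∀ m {n} (f : Fin (m + n) → Carrier) →
    sum f ≈ sum (λ i → f (i ↑ˡ n)) ∙ sum (λ j → f (m ↑ʳ j))
  sum-↑ zero    f = ≈-sym (identityˡ _)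
  sum-↑ (suc m) f = ≈-trans (∙-congˡ (sum-↑ m (f ∘ suc))) (≈-sym (assoc _ _ _))

  if-∨ : ∀ b c {x} → ¬ (b ≡ true × c ≡ true) →
    (if b ∨ c then x else ε) ≈ (if b then x else ε) ∙ (if c then x else ε)
  if-∨ true  true  ¬both = contradiction (refl , refl) ¬both
  if-∨ true  false _     = ≈-sym (identityʳ _)
  if-∨ false _     _     = ≈-sym (identityˡ _)

module WeightProperties {c ℓ₁ ℓ₂} (R : OrderedAbelianGroup c ℓ₁ ℓ₂) where
  open OrderedAbelianGroup R using (Carrier; _≈_; _⊕_; 0#; commutativeMonoid; reflexive; ∙-cong)
    renaming (trans to ≈-trans; sym to ≈-sym)
  open Weights R
  open Summation commutativeMonoid using (sum-cong-≋; sum-cong-≗; ∑-distrib-+)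

  -- By disjointness no node is counted twice, so the identity holds term by term.
  weight-∪ : ∀ {n} (w : Fin n → Carrier) {p q : Subset n} → Empty (p ∩ q) →
    weight w (p ∪ q) ≈ weight w p ⊕ weight w q
  weight-∪ {n} w {p} {q} disj =
    ≈-trans (sum-cong-≋ pointwise) (∑-distrib-+ (term p) (term q))
    where
    term : Subset n → Fin n → Carrier
    term r v = if lookup r v then w v else 0#

    pointwise : ∀ v → term (p ∪ q) v ≈ term p v ⊕ term q v
    -- Union of subsets is `zipWith _∨_`, so the test for membership becomes a disjunction of two
    -- booleans.
    pointwise v rewrite lookup-zipWith _∨_ v p q =
      if-∨ commutativeMonoid (lookup p v) (lookup q v) λ (v∈p , v∈q) →
        disj (v , x∈p∩q⁺ (lookup⇒[]= v p v∈p , lookup⇒[]= v q v∈q))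

  -- The sum over `Fin (n + n)` breaks at `n`, and `H-weights w` restricts to `w` on each half.
  H-weight-++ : ∀ {n} (w : Fin n → Carrier) (p q : Subset n) →
    weight (H-weights w) (p ++ q) ≈ weight w p ⊕ weight w q
  H-weight-++ {n} w p q = ≈-trans (sum-↑ commutativeMonoid n _)
    (∙-cong (reflexive (sum-cong-≗ left)) (reflexive (sum-cong-≗ right)))
    where
    left : ∀ i → (if lookup (p ++ q) (i ↑ˡ n) then H-weights w (i ↑ˡ n) else 0#) ≡
                 (if lookup p i then w i else 0#)
    left i rewrite lookup-++ˡ p q i | splitAt-↑ˡ n i n = refl

    right : ∀ j → (if lookup (p ++ q) (n ↑ʳ j) then H-weights w (n ↑ʳ j) else 0#) ≡
                  (if lookup q j then w j else 0#)
    right j rewrite lookup-++ʳ p q j | splitAt-↑ʳ n n j = refl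

  weight-∪-++ : ∀ {n} (w : Fin n → Carrier) (p q : Subset n) → Empty (p ∩ q) →
    weight w (p ∪ q) ≈ weight (H-weights w) (p ++ q)
  weight-∪-++ w p q disj = ≈-trans (weight-∪ w disj) (≈-sym (H-weight-++ w p q))

theorem1 : ∀ {c ℓ₁ ℓ₂} (R : OrderedAbelianGroup c ℓ₁ ℓ₂) →
    let open OrderedAbelianGroup R
        open Weights R
    in ∀ (n : ℕ) (G : Graph (Fin n)) (w : Fin n → Carrier) → (∀ v → 0# ≤ w v) →
      (∀ (Wᴵ : Subset (n + n)) → Independent (H G) (_∈ Wᴵ) →
        ∃ λ (Wᴮ : Subset n) → Bipartite (induced G (_∈ Wᴮ)) × weight w Wᴮ ≈ weight (H-weights w) Wᴵ)
      ×
      (∀ (Wᴮ : Subset n) → Bipartite (induced G (_∈ Wᴮ)) →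
        ∃ λ (Wᴵ : Subset (n + n)) → Independent (H G) (_∈ Wᴵ) × weight (H-weights w) Wᴵ ≈ weight w Wᴮ)
theorem1 R n G w _ = to , from
  where
  open OrderedAbelianGroup R using (_≈_) renaming (sym to ≈-sym)
  open Weights R
  open WeightProperties R

  to : ∀ (Wᴵ : Subset (n + n)) → Independent (H G) (_∈ Wᴵ) →
    ∃ λ (Wᴮ : Subset n) → Bipartite (induced G (_∈ Wᴮ)) × weight w Wᴮ ≈ weight (H-weights w) Wᴵ
  -- Every subset of the nodes of `H G` is the concatenation of its traces on the two copies of the
  -- node set.
  to Wᴵ ind with Vec.splitAt n Wᴵ
  ... | W₁ , W₂ , refl =
    let bip@(_ , _ , disj) = Independent-H⇒IsBipartition G ind
    in W₁ ∪ W₂ , IsBipartition⇒Bipartite G bip , weight-∪-++ w W₁ W₂ disj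

  from : ∀ (Wᴮ : Subset n) → Bipartite (induced G (_∈ Wᴮ)) →
    ∃ λ (Wᴵ : Subset (n + n)) → Independent (H G) (_∈ Wᴵ) × weight (H-weights w) Wᴵ ≈ weight w Wᴮ
  from Wᴮ bipartite with Bipartite⇒IsBipartition G Wᴮ bipartite
  ... | W₁ , W₂ , refl , bip@(_ , _ , disj) =
    W₁ ++ W₂ , IsBipartition⇒Independent-H G bip , ≈-sym (weight-∪-++ w W₁ W₂ disj)
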